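{- For every even positive integer $n$, $$f'(n)\le g(n)\le f(n)\le p(n).$$
   Context: For a partition $\lambda=\{d_1\ge d_2\ge\cdots\ge d_\ell\}$ of $n$ (positive integer parts with sum $n$), let $k$ be the number of indices $m$ with $d_m\ge m$ (the length of the main diagonal of the Ferrers diagram of $\lambda$). The Frobenius partition of $\lambda$ is the two-row array $\begin{pmatrix} a_1&a_2&\cdots&a_k\\ b_1&b_2&\cdots&b_k\end{pmatrix}$, where for $1\le m\le k$, $a_m=d_m-m$ is the number of cells of row $m$ of the Ferrers diagram strictly to the right of the diagonal, and $b_m$ is the number of cells of column $m$ strictly below the diagonal; equivalently $b_m=\frac{m(m-1)}{2}+\sum_{i=m+1}^{\ell}\min\{m,d_i\}-\sum_{i=1}^{m-1}b_i$. Partitions of $n$ correspond bijectively to Frobenius partitions of weight $n$. Definitions of the four counting functions: - $p(n)$ is the number of integer partitions of $n$. - $g(n)$ is the number of graphical partitions of $n$, i.e. partitions of $n$ whose parts are the vertex degrees of some simple undirected graph. - $f(n)$ is the number of partitions of $n$ whose Frobenius partition satisfies $k+\sum_{i=1}^{k}a_i\le\sum_{i=1}^{k}b_i$. - $f'(n)$ is the number of partitions of $n$ whose Frobenius partition satisfies $a_m-b_m\le -1$ for each $1\le m\le k$. -}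

module Defs where

open import Data.Empty using (⊥-elim)
open import Data.Fin using (Fin; zero; suc)
import Data.Fin.Properties as Fin
open import Data.Fin.Subset using (Subset; ∣_∣) renaming (_∈_ to _∈ₛ_; _∉_ to _∉ₛ_)
open import Data.Fin.Subset.Properties using (anySubset?) renaming (_∈?_ to _∈ₛ?_)
open import Data.Integer as ℤ using (+_; -1ℤ)
import Data.Integer.Properties as ℤ
open import Data.List using (List; []; _∷_; [_]; _++_; length; lookup; map; filter; applyUpTo)
open import Data.List.Membership.Propositional using (_∈_)
open import Data.List.Membership.Propositional.Properties
  using (∈-++⁻; ∈-++⁺ˡ; ∈-++⁺ʳ; ∈-map⁺; ∈-map⁻)
import Data.List.Properties as List
open import Data.List.Relation.Binary.Disjoint.Propositional using (Disjoint)
open import Data.List.Relation.Unary.All as All using (All; []; _∷_)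
open import Data.List.Relation.Unary.AllPairs using ([]; _∷_)
open import Data.List.Relation.Unary.Any using (here; there)
open import Data.List.Relation.Unary.Linked as Linked using (Linked; []; [-]; _∷_)
open import Data.List.Relation.Unary.Linked.Properties using (Linked⇒All)
open import Data.List.Relation.Unary.Unique.Propositional using (Unique)
import Data.List.Relation.Unary.Unique.Propositional.Properties as Unique
open import Data.Nat using (ℕ; zero; suc; _+_; _∸_; _≤_; _≥_; _<_; z≤n; s≤s; _≤?_; _<?_)
open import Data.Nat.ListAction using (sum)
open import Data.Nat.Properties
open import Data.Product using (Σ; ∃; _×_; _,_; proj₁; proj₂)
open import Data.Sum using (inj₁; inj₂)
open import Data.Vec as Vec using (Vec; []; _∷_)
import Data.Vec.Properties as Vec
open import Function using (_∘_; _⇔_; mk⇔)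
open import Relation.Binary.PropositionalEquality
  using (_≡_; refl; sym; trans; cong; subst)
open import Relation.Nullary using (Dec; yes; no; ¬?; _×-dec_; _→-dec_; map′)
open import Relation.Unary using (Pred; Decidable)

------------------------------------------------------------------------
-- Partitions

record IsPartition (n : ℕ) (ds : List ℕ) : Set where
  constructor isPartition
  field
    positive   : All (0 <_) ds
    decreasing : Linked _≥_ ds
    total      : sum ds ≡ n

-- boundedPartitions k m n lists the partitions of n into at most k parts,
-- each of size at most m.
boundedPartitions : ℕ → ℕ → ℕ → List (List ℕ)
boundedPartitions k       m       zero    = [ [] ]
boundedPartitions zero    m       (suc n) = []
boundedPartitions (suc k) zero    (suc n) = []
boundedPartitions (suc k) (suc m) (suc n) with m ≤? n
... | yes _ = map (suc m ∷_) (boundedPartitions k (suc m) (n ∸ m))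
              ++ boundedPartitions (suc k) m (suc n)
... | no  _ = boundedPartitions (suc k) m (suc n)

partitions : ℕ → List (List ℕ)
partitions n = boundedPartitions n n n

-- The next results show that partitions n contains every partition of n,
-- exactly once, and nothing else.

private
  cons-linked : ∀ {d ds} → All (_≤ d) ds → Linked _≥_ ds → Linked _≥_ (d ∷ ds)
  cons-linked []      []       = [-]
  cons-linked (p ∷ _) [-]      = p ∷ [-]
  cons-linked (p ∷ _) (q ∷ qs) = p ∷ q ∷ qs

  bounded-sound : ∀ k m n {ds} → ds ∈ boundedPartitions k m n →
                  IsPartition n ds × All (_≤ m) ds
  bounded-sound k m zero (here refl) = isPartition [] [] refl , []
  bounded-sound (suc k) (suc m) (suc n) p with m ≤? n
  ... | no _ with q , b ← bounded-sound (suc k) m (suc n) p = q , All.map m≤n⇒m≤1+n b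
  ... | yes m≤n with ∈-++⁻ (map (suc m ∷_) (boundedPartitions k (suc m) (n ∸ m))) p
  ...   | inj₂ p′ with q , b ← bounded-sound (suc k) m (suc n) p′ = q , All.map m≤n⇒m≤1+n b
  ...   | inj₁ p′ with es , es∈ , refl ← ∈-map⁻ (suc m ∷_) p′
                  with isPartition pos dec tot , b ← bounded-sound k (suc m) (n ∸ m) es∈ =
    isPartition (s≤s z≤n ∷ pos) (cons-linked b dec)
      (cong suc (trans (cong (_+_ m) tot) (m+[n∸m]≡n m≤n))) ,
    ≤-refl ∷ b

  bounded-complete : ∀ k m n {ds} → IsPartition n ds → All (_≤ m) ds → length ds ≤ k →
                     ds ∈ boundedPartitions k m n
  bounded-complete k m zero {[]} _ _ _ = here refl
  bounded-complete k m zero {suc d ∷ ds} (isPartition _ _ ()) _ _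
  bounded-complete k m zero {zero ∷ ds} (isPartition (() ∷ _) _ _) _ _
  bounded-complete k m (suc n) {[]} (isPartition _ _ ()) _ _
  bounded-complete (suc k) zero (suc n) {zero ∷ ds} (isPartition (() ∷ _) _ _) _ _
  bounded-complete (suc k) zero (suc n) {suc d ∷ ds} _ (() ∷ _) _
  bounded-complete (suc k) (suc m) (suc n) {d ∷ ds} (isPartition (p ∷ pos) dec tot) (b ∷ bs) (s≤s l)
    with m ≤? n | m≤n⇒m<n∨m≡n b
  ... | no _ | inj₁ (s≤s d≤m) =
    bounded-complete (suc k) m (suc n) (isPartition (p ∷ pos) dec tot)
      (Linked⇒All (λ x y → ≤-trans y x) d≤m dec) (s≤s l)
  ... | no m≰n | inj₂ refl = ⊥-elim (m≰n (subst (m ≤_) (suc-injective tot) (m≤m+n m (sum ds))))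
  ... | yes _ | inj₁ (s≤s d≤m) =
    ∈-++⁺ʳ (map (suc m ∷_) (boundedPartitions k (suc m) (n ∸ m)))
      (bounded-complete (suc k) m (suc n) (isPartition (p ∷ pos) dec tot)
        (Linked⇒All (λ x y → ≤-trans y x) d≤m dec) (s≤s l))
  ... | yes _ | inj₂ refl =
    ∈-++⁺ˡ (∈-map⁺ (suc m ∷_) (bounded-complete k (suc m) (n ∸ m)
      (isPartition pos (Linked.tail dec)
        (trans (sym (m+n∸m≡n m (sum ds))) (cong (_∸ m) (suc-injective tot)))) bs l))

  bounded-unique : ∀ k m n → Unique (boundedPartitions k m n)
  bounded-unique k       m       zero    = [] ∷ []
  bounded-unique zero    m       (suc n) = []
  bounded-unique (suc k) zero    (suc n) = []
  bounded-unique (suc k) (suc m) (suc n) with m ≤? n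
  ... | no  _ = bounded-unique (suc k) m (suc n)
  ... | yes _ = Unique.++⁺ (Unique.map⁺ List.∷-injectiveʳ (bounded-unique k (suc m) (n ∸ m)))
                           (bounded-unique (suc k) m (suc n)) disjoint
    where
    disjoint : Disjoint (map (suc m ∷_) (boundedPartitions k (suc m) (n ∸ m)))
                        (boundedPartitions (suc k) m (suc n))
    disjoint (p , q) with _ , _ , refl ← ∈-map⁻ (suc m ∷_) p
                     with _ , (b ∷ _) ← bounded-sound (suc k) m (suc n) q = 1+n≰n b

  all≤sum : ∀ ds → All (_≤ sum ds) ds
  all≤sum []       = []
  all≤sum (d ∷ ds) = m≤m+n d _ ∷ All.map (λ p → ≤-trans p (m≤n+m _ d)) (all≤sum ds)

  length≤sum : ∀ {ds} → All (0 <_) ds → length ds ≤ sum ds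
  length≤sum []       = z≤n
  length≤sum (p ∷ ps) = +-mono-≤ p (length≤sum ps)

∈-partitions : ∀ {n ds} → ds ∈ partitions n ⇔ IsPartition n ds
∈-partitions {n} {ds} = mk⇔ (proj₁ ∘ bounded-sound n n n) complete
  where
  complete : IsPartition n ds → ds ∈ partitions n
  complete q@(isPartition pos _ refl) =
    bounded-complete n n n q (all≤sum ds) (length≤sum pos)

partitions-unique : ∀ n → Unique (partitions n)
partitions-unique n = bounded-unique n n n

countPartitions : ∀ {ℓ} {P : Pred (List ℕ) ℓ} → Decidable P → ℕ → ℕ
countPartitions P? n = length (filter P? (partitions n))

------------------------------------------------------------------------
-- Simple graphs and graphical partitions

record SimpleGraph (v : ℕ) : Set where
  field
    neighbours : Fin v → Subset v
    irrefl     : ∀ i → i ∉ₛ neighbours i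
    symmetric  : ∀ i j → j ∈ₛ neighbours i → i ∈ₛ neighbours j

  degree : Fin v → ℕ
  degree i = ∣ neighbours i ∣

open SimpleGraph public using (degree)

-- Relabelling vertices if necessary, vertex i has the i-th part as its degree.
Graphical : List ℕ → Set
Graphical ds = Σ (SimpleGraph (length ds)) λ G → ∀ i → degree G i ≡ lookup ds i

-- Exhaustive search over all families of neighbourhoods.
private
  anyVec? : ∀ {ℓ v m} {P : Pred (Vec (Subset v) m) ℓ} → Decidable P → Dec (∃ P)
  anyVec? {m = zero} P? = map′ (λ p → [] , p) (λ { ([] , p) → p }) (P? [])
  anyVec? {m = suc m} P? =
    map′ (λ { (s , ss , p) → s ∷ ss , p }) (λ { (s ∷ ss , p) → s , ss , p })
         (anySubset? λ s → anyVec? λ ss → P? (s ∷ ss))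

  Realises : (ds : List ℕ) → Vec (Subset (length ds)) (length ds) → Set
  Realises ds N = (∀ i → i ∉ₛ Vec.lookup N i)
                × (∀ i j → j ∈ₛ Vec.lookup N i → i ∈ₛ Vec.lookup N j)
                × (∀ i → ∣ Vec.lookup N i ∣ ≡ lookup ds i)

  realises? : ∀ ds → Decidable (Realises ds)
  realises? ds N =
    Fin.all? (λ i → ¬? (i ∈ₛ? Vec.lookup N i))
    ×-dec Fin.all? (λ i → Fin.all? λ j → (j ∈ₛ? Vec.lookup N i) →-dec (i ∈ₛ? Vec.lookup N j))
    ×-dec Fin.all? (λ i → ∣ Vec.lookup N i ∣ ≟ lookup ds i)

graphical? : Decidable Graphical
graphical? ds = map′ to from (anyVec? (realises? ds))
  where
  to : ∃ (Realises ds) → Graphical ds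
  to (N , irr , sy , deg) =
    record { neighbours = Vec.lookup N ; irrefl = irr ; symmetric = sy } , deg

  from : Graphical ds → ∃ (Realises ds)
  from (G , deg) = Vec.tabulate N
    , (λ i p → G.irrefl i (subst (i ∈ₛ_) (lk i) p))
    , (λ i j p → subst (i ∈ₛ_) (sym (lk j)) (G.symmetric i j (subst (j ∈ₛ_) (lk i) p)))
    , (λ i → trans (cong ∣_∣ (lk i)) (deg i))
    where
    module G = SimpleGraph G
    N  = G.neighbours
    lk = Vec.lookup∘tabulate N

------------------------------------------------------------------------
-- Frobenius partitions

-- Row and column indices are 1-based.

[1⋯_] : ℕ → List ℕ
[1⋯ n ] = applyUpTo suc n

-- part ds m is the m-th part d_m, and 0 if there is none.
part : List ℕ → ℕ → ℕ
part []       m             = 0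
part (d ∷ ds) zero          = 0
part (d ∷ ds) (suc zero)    = d
part (d ∷ ds) (suc (suc m)) = part ds (suc m)

diagonal : List ℕ → ℕ
diagonal ds = length (filter (λ m → m ≤? part ds m) [1⋯ length ds ])

-- Used only for 1 ≤ m ≤ diagonal ds; the truncated subtraction is then exact
-- for partitions, since d_m ≥ m.
a : List ℕ → ℕ → ℕ
a ds m = part ds m ∸ m

-- Row i meets column m exactly when d_i ≥ m, and that cell lies strictly below
-- the diagonal when i > m.
b : List ℕ → ℕ → ℕ
b ds m = length (filter (λ i → (m <? i) ×-dec (m ≤? part ds i)) [1⋯ length ds ])

SumCondition : List ℕ → Set
SumCondition ds = k + sum (map (a ds) [1⋯ k ]) ≤ sum (map (b ds) [1⋯ k ])
  where k = diagonal ds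

sumCondition? : Decidable SumCondition
sumCondition? ds = _ ≤? _

TermwiseCondition : List ℕ → Set
TermwiseCondition ds = All (λ m → + a ds m ℤ.- + b ds m ℤ.≤ -1ℤ) [1⋯ diagonal ds ]

termwiseCondition? : Decidable TermwiseCondition
termwiseCondition? ds = All.all? (λ m → _ ℤ.≤? _) [1⋯ diagonal ds ]

------------------------------------------------------------------------
-- The four counting functions

p : ℕ → ℕ
p n = length (partitions n)

g : ℕ → ℕ
g = countPartitions graphical?

f : ℕ → ℕ
f = countPartitions sumCondition?

f′ : ℕ → ℕ
f′ = countPartitions termwiseCondition?

{-# OPTIONS --safe #-}

-- Number the rows of the diagram from 0 and join i < j whenever row j meets column
-- i.  This graph F is complete on the first k vertices and has no edge among the
-- others, and vertex i has degree b_i + i if i < k, and d_i otherwise.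
--
-- Any graph with degrees d agrees with F in the degrees outside the first k
-- vertices, and F maximises the sum of the first k degrees under that constraint.
-- Cancelling the indices in Σ (a_i + 1 + i) ≤ Σ (b_i + i) gives g ≤ f.
--
-- If a_i < b_i for all i < k, then the degrees of F exceed d only on the first k
-- vertices, and by an even total.  While there is excess, two units of it, at x and
-- y (possibly equal), are removed by deleting the edge xy, or by replacing edges xu
-- and yv with uv; suitable u and v exist because the vertices outside the first k
-- have degree at most k, while x and y have degree more than k.  So f′ ≤ g.

module Submission where

open import Defs
open import Data.Nat using (ℕ; _≤_; _<_)
open import Data.Nat.Divisibility using (_∣_)
open import Data.Product using (_×_)

open import Data.Bool using (Bool; true; false; not; _xor_)
open import Data.Bool.Properties using (xor-identityʳ; ¬-not; ⇔→≡)
open import Data.Fin using (Fin; zero; suc; toℕ; fromℕ<)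
open import Data.Fin.Properties as Fin using (_≟_; toℕ<n; toℕ-fromℕ<; ¬∀⟶∃¬)
open import Data.Fin.Subset using (Subset; ∣_∣)
import Data.Integer as ℤ
import Data.Integer.Properties as ℤ
open import Data.List using (List; []; _∷_; length; lookup; map; filter; applyUpTo)
import Data.List.Properties as List
import Data.Nat.ListAction as List
open import Data.List.Membership.Propositional.Properties using (∈-lookup)
open import Data.List.Relation.Unary.All as All using (All; []; _∷_)
import Data.List.Relation.Unary.All.Properties as All
open import Data.List.Relation.Unary.AllPairs using (AllPairs; []; _∷_)
open import Data.List.Relation.Unary.Linked.Properties using (Linked⇒AllPairs)
open import Data.Nat
  using (zero; suc; _+_; _*_; _∸_; _≥_; z≤n; s≤s; s≤s⁻¹; _≤?_; _<?_)
open import Data.Nat.Divisibility using (∣m+n∣m⇒∣n; ∣m∣n⇒∣m+n; m∣m*n; _∣0)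
open import Data.Nat.Properties hiding (_≟_)
open import Data.Nat.Tactic.RingSolver using (solve-∀)
open import Data.Product using (∃; ∃₂; _,_; proj₁; proj₂)
open import Data.Sum using (_⊎_; inj₁; inj₂; swap)
import Data.Vec as Vec
import Data.Vec.Properties as Vec
open import Function using (_∘_; _⇔_; mk⇔; Equivalence)
open import Relation.Binary.PropositionalEquality
  using (_≡_; _≢_; refl; sym; trans; cong; cong₂; subst; subst₂; module ≡-Reasoning)
open import Relation.Binary using (tri<; tri≈; tri>)
open import Relation.Nullary
  using (¬_; Dec; yes; no; does; proof; contradiction; _×-dec_; _⊎-dec_)
open import Relation.Nullary.Reflects using (Reflects; invert)
open import Relation.Nullary.Decidable using (does-⇔; dec-true; dec-false)
open import Relation.Unary using (Pred; Decidable)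
open import Algebra.Properties.Semiring.Sum +-*-semiring
  using (sum; sum-syntax; sum-cong-≗; ∑-distrib-+; ∑-comm; *-distribˡ-sum)

open Equivalence using (to; from)

-- Indicators and finite sums

bit : Bool → ℕ
bit true  = 1
bit false = 0

𝟙 : ∀ {ℓ} {P : Set ℓ} → Dec P → ℕ
𝟙 P? = bit (does P?)

bit≤1 : ∀ x → bit x ≤ 1
bit≤1 true  = ≤-refl
bit≤1 false = z≤n

bit>0 : ∀ {x m} → m < bit x → x ≡ true
bit>0 {true} _ = refl

𝟙-true : ∀ {ℓ} {P : Set ℓ} (P? : Dec P) → P → 𝟙 P? ≡ 1
𝟙-true P? = cong bit ∘ dec-true P?

𝟙-false : ∀ {ℓ} {P : Set ℓ} (P? : Dec P) → ¬ P → 𝟙 P? ≡ 0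
𝟙-false P? = cong bit ∘ dec-false P?

𝟙-⊎ : ∀ {ℓ ℓ′} {P : Set ℓ} {Q : Set ℓ′} (P? : Dec P) (Q? : Dec Q) → ¬ (P × Q) →
      𝟙 (P? ⊎-dec Q?) ≡ 𝟙 P? + 𝟙 Q?
𝟙-⊎ (yes p) (yes q) disjoint = contradiction (p , q) disjoint
𝟙-⊎ (yes p) (no _)  _        = refl
𝟙-⊎ (no _)  (yes q) _        = refl
𝟙-⊎ (no _)  (no _)  _        = refl

𝟙-× : ∀ {ℓ ℓ′} {P : Set ℓ} {Q : Set ℓ′} (P? : Dec P) (Q? : Dec Q) →
      𝟙 (P? ×-dec Q?) ≡ 𝟙 P? * 𝟙 Q?
𝟙-× (yes _) (yes _) = refl
𝟙-× (yes _) (no _)  = refl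
𝟙-× (no _)  _       = refl

-- Toggling an entry by `xor` deletes it if present and inserts it if absent; this lemma covers
-- deletion and `bit-xor-add` insertion. The subtraction is moved across the equation to avoid
-- truncation.
bit-xor-remove : ∀ {ℓ x} {P : Set ℓ} (P? : Dec P) → (P → x ≡ true) →
                 bit (x xor does P?) + 𝟙 P? ≡ bit x
bit-xor-remove         (yes p) x≡true rewrite x≡true p = refl
bit-xor-remove {x = x} (no _)  _ = trans (+-identityʳ _) (cong bit (xor-identityʳ x))

bit-xor-add : ∀ {ℓ x} {P : Set ℓ} (P? : Dec P) → (P → x ≡ false) →
              bit (x xor does P?) ≡ bit x + 𝟙 P?
bit-xor-add         (yes p) x≡false rewrite x≡false p = refl
bit-xor-add {x = x} (no _)  _ = trans (cong bit (xor-identityʳ x)) (sym (+-identityʳ _))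

𝟙-⇔ : ∀ {ℓ ℓ′} {P : Set ℓ} {Q : Set ℓ′} → P ⇔ Q → (P? : Dec P) (Q? : Dec Q) → 𝟙 P? ≡ 𝟙 Q?
𝟙-⇔ P⇔Q P? Q? = cong bit (does-⇔ P⇔Q P? Q?)

sum-mono : ∀ {n} {t u : Fin n → ℕ} → (∀ i → t i ≤ u i) → sum t ≤ sum u
sum-mono {zero}  t≤u = z≤n
sum-mono {suc n} t≤u = +-mono-≤ (t≤u zero) (sum-mono (t≤u ∘ suc))

sum-bit≤n : ∀ {n} (S : Fin n → Bool) → ∑[ i < n ] bit (S i) ≤ n
sum-bit≤n {zero}  S = z≤n
sum-bit≤n {suc n} S = +-mono-≤ (bit≤1 (S zero)) (sum-bit≤n (S ∘ suc))

sum-<⇒∃ : ∀ {n} {t u : Fin n → ℕ} → sum t < sum u → ∃ λ i → t i < u i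
sum-<⇒∃ {n} {t} {u} lt with i , ui≰ti ← ¬∀⟶∃¬ n (λ i → u i ≤ t i) (λ i → u i ≤? t i)
                                              (λ u≤t → <⇒≱ lt (sum-mono u≤t)) = i , ≰⇒> ui≰ti

sum-zero : ∀ {n} {t : Fin n → ℕ} → (∀ i → t i ≡ 0) → sum t ≡ 0
sum-zero {zero}  t≡0 = refl
sum-zero {suc n} t≡0 = cong₂ _+_ (t≡0 zero) (sum-zero (t≡0 ∘ suc))

sum≡0⇒≡0 : ∀ {n} {t : Fin n → ℕ} → sum t ≡ 0 → ∀ i → t i ≡ 0
sum≡0⇒≡0 {t = t} eq zero    = m+n≡0⇒m≡0 (t zero) eq
sum≡0⇒≡0 {t = t} eq (suc i) = sum≡0⇒≡0 (m+n≡0⇒n≡0 (t zero) eq) i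

sum-𝟙-< : ∀ {m n} → m ≤ n → ∑[ i < n ] 𝟙 (toℕ i <? m) ≡ m
sum-𝟙-< {n = n} z≤n = sum-zero {n} λ _ → refl
sum-𝟙-< (s≤s m≤n)   = cong suc (sum-𝟙-< m≤n)

δ : ∀ {n} → Fin n → Fin n → ℕ
δ x i = 𝟙 (x ≟ i)

δ-refl : ∀ {n} (x : Fin n) → δ x x ≡ 1
δ-refl x = 𝟙-true (x ≟ x) refl

sum-δ : ∀ {n} (x : Fin n) → sum (δ x) ≡ 1
sum-δ {suc n} zero    = cong suc (sum-zero {n} λ _ → refl)
sum-δ {suc n} (suc x) = sum-δ x

-- Takes one unit from the first nonzero entry; used twice to pick the two vertices whose degrees
-- are lowered.
δ-split : ∀ {n s} (e : Fin n → ℕ) → sum e ≡ suc s →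
          ∃₂ λ x e′ → (∀ i → e i ≡ δ x i + e′ i) × sum e′ ≡ s
δ-split {suc n} e eq with e zero in e₀
... | suc c = zero , (λ { zero → c ; (suc i) → e (suc i) })
            , (λ { zero → e₀ ; (suc i) → refl }) , suc-injective eq
... | zero with x , e′ , e≡ , eq′ ← δ-split (e ∘ suc) eq
           = suc x , (λ { zero → 0 ; (suc i) → e′ i })
           , (λ { zero → e₀ ; (suc i) → e≡ i }) , eq′

-- Peel off the first row and column: their corner is zero and by symmetry they have equal sums, so
-- together they contribute `2 * row`.
sum-sym-even : ∀ {n} (M : Fin n → Fin n → ℕ) → (∀ i → M i i ≡ 0) → (∀ i j → M i j ≡ M j i) →
               2 ∣ ∑[ i < n ] sum (M i)
sum-sym-even {zero}  M irr sm = 2 ∣0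
sum-sym-even {suc n} M irr sm = subst (2 ∣_) (sym eq)
  (∣m∣n⇒∣m+n (m∣m*n row) (sum-sym-even (λ i j → M (suc i) (suc j)) (irr ∘ suc) (λ i j → sm (suc i) (suc j))))
  where
  open ≡-Reasoning
  row  = ∑[ j < n ] M zero (suc j)
  rest = ∑[ i < n ] ∑[ j < n ] M (suc i) (suc j)
  double : ∀ r s → 0 + r + (r + s) ≡ 2 * r + s
  double = solve-∀
  eq : ∑[ i < suc n ] sum (M i) ≡ 2 * row + rest
  eq = begin
    M zero zero + row + ∑[ i < n ] (M (suc i) zero + ∑[ j < n ] M (suc i) (suc j))
      ≡⟨ cong₂ (λ z s → z + row + s) (irr zero) (∑-distrib-+ (λ i → M (suc i) zero) _) ⟩
    0 + row + (∑[ i < n ] M (suc i) zero + rest)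
      ≡⟨ cong (λ r → 0 + row + (r + rest)) (sum-cong-≗ λ i → sm (suc i) zero) ⟩
    0 + row + (row + rest)
      ≡⟨ double row rest ⟩
    2 * row + rest ∎

-- Graphs as Boolean adjacency matrices

-- With Boolean entries, edges are flipped by `xor` and degrees are finite sums that can be split
-- and exchanged.
record Graph (n : ℕ) : Set where
  field
    adj        : Fin n → Fin n → Bool
    adj-irrefl : ∀ i → adj i i ≡ false
    adj-sym    : ∀ i j → adj i j ≡ adj j i

  deg : Fin n → ℕ
  deg i = ∑[ j < n ] bit (adj i j)

open Graph

handshake : ∀ {n} (G : Graph n) → 2 ∣ sum (deg G)
handshake G = sum-sym-even (λ i j → bit (adj G i j)) (cong bit ∘ adj-irrefl G)
                           (λ i j → cong bit (adj-sym G i j))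

adj⇒≢ : ∀ {n} (G : Graph n) {x y} → adj G x y ≡ true → x ≢ y
adj⇒≢ G {x} xy refl with () ← trans (sym xy) (adj-irrefl G x)

-- Toggling edges and lowering degrees

Edge : ∀ {n} → (x y i j : Fin n) → Set
Edge x y i j = (x ≡ i × y ≡ j) ⊎ (x ≡ j × y ≡ i)

edge? : ∀ {n} (x y i j : Fin n) → Dec (Edge x y i j)
edge? x y i j = (x ≟ i ×-dec y ≟ j) ⊎-dec (x ≟ j ×-dec y ≟ i)

toggle : ∀ {n} {x y : Fin n} → x ≢ y → Graph n → Graph n
toggle {x = x} {y} x≢y G = record
  { adj        = λ i j → adj G i j xor does (edge? x y i j)
  ; adj-irrefl = λ i → cong₂ _xor_ (adj-irrefl G i) (dec-false (edge? x y i i)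
      λ { (inj₁ (x≡i , y≡i)) → x≢y (trans x≡i (sym y≡i))
        ; (inj₂ (x≡i , y≡i)) → x≢y (trans x≡i (sym y≡i)) })
  ; adj-sym    = λ i j → cong₂ _xor_ (adj-sym G i j)
      (does-⇔ (mk⇔ swap swap) (edge? x y i j) (edge? x y j i))
  }

-- As `x ≢ y`, the two orientations of the edge exclude each other, so its indicator is a sum of two
-- products of `δ`, and each product sums over `j` to one `δ`.
sum-edge : ∀ {n} {x y : Fin n} → x ≢ y → ∀ i →
           ∑[ j < n ] 𝟙 (edge? x y i j) ≡ δ x i + δ y i
sum-edge {n} {x} {y} x≢y i = begin
  ∑[ j < n ] 𝟙 (edge? x y i j)                  ≡⟨ sum-cong-≗ pointwise ⟩
  ∑[ j < n ] (δ x i * δ y j + δ y i * δ x j)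
    ≡⟨ ∑-distrib-+ (λ j → δ x i * δ y j) (λ j → δ y i * δ x j) ⟩
  ∑[ j < n ] (δ x i * δ y j) + ∑[ j < n ] (δ y i * δ x j)
    ≡⟨ cong₂ _+_ (sym (*-distribˡ-sum (δ x i) (δ y))) (sym (*-distribˡ-sum (δ y i) (δ x))) ⟩
  δ x i * sum (δ y) + δ y i * sum (δ x)
    ≡⟨ cong₂ (λ s t → δ x i * s + δ y i * t) (sum-δ y) (sum-δ x) ⟩
  δ x i * 1 + δ y i * 1                         ≡⟨ cong₂ _+_ (*-identityʳ (δ x i)) (*-identityʳ (δ y i)) ⟩
  δ x i + δ y i                                 ∎
  where
  open ≡-Reasoning
  pointwise : ∀ j → 𝟙 (edge? x y i j) ≡ δ x i * δ y j + δ y i * δ x j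
  pointwise j = trans
    (𝟙-⊎ (x ≟ i ×-dec y ≟ j) (x ≟ j ×-dec y ≟ i)
      (λ { ((x≡i , _) , (_ , y≡i)) → x≢y (trans x≡i (sym y≡i)) }))
    (cong₂ _+_ (𝟙-× (x ≟ i) (y ≟ j))
               (trans (𝟙-× (x ≟ j) (y ≟ i)) (*-comm (δ x j) (δ y i))))

adj-edge : ∀ {n} (G : Graph n) {x y i j} → Edge x y i j → adj G i j ≡ adj G x y
adj-edge G (inj₁ (refl , refl)) = refl
adj-edge G (inj₂ (refl , refl)) = adj-sym G _ _

deg-remove : ∀ {n} (G : Graph n) {x y} (x≢y : x ≢ y) → adj G x y ≡ true →
             ∀ i → deg (toggle x≢y G) i + (δ x i + δ y i) ≡ deg G i
deg-remove G {x} {y} x≢y xy i = trans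
  (cong (deg (toggle x≢y G) i +_) (sym (sum-edge x≢y i)))
  (trans (sym (∑-distrib-+ (λ j → bit (adj (toggle x≢y G) i j)) _))
    (sum-cong-≗ λ j → bit-xor-remove (edge? x y i j) λ e → trans (adj-edge G e) xy))

deg-add : ∀ {n} (G : Graph n) {x y} (x≢y : x ≢ y) → adj G x y ≡ false →
          ∀ i → deg (toggle x≢y G) i ≡ deg G i + (δ x i + δ y i)
deg-add G {x} {y} x≢y xy i = trans
  (trans (sum-cong-≗ λ j → bit-xor-add (edge? x y i j) λ e → trans (adj-edge G e) xy)
         (∑-distrib-+ (λ j → bit (adj G i j)) _))
  (cong (deg G i +_) (sum-edge x≢y i))

-- The size of a neighbourhood enlarged by one vertex; it is applied only with `y` outside N(x).
sum-adj+δ : ∀ {n} (G : Graph n) x y → ∑[ i < n ] (bit (adj G x i) + δ y i) ≡ suc (deg G x)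
sum-adj+δ G x y = trans (∑-distrib-+ (λ i → bit (adj G x i)) (δ y))
                        (trans (cong (deg G x +_) (sum-δ y)) (+-comm (deg G x) 1))

-- Compare N(u) ∪ {u} with N(y) ∪ {x}: the vertex x is in both, so the larger set
-- has an element v ≠ x outside the smaller one.
switchable : ∀ {n} (G : Graph n) {x y u} → adj G x y ≡ false → adj G x u ≡ true → deg G u < deg G y →
             ∃ λ v → adj G y v ≡ true × u ≢ v × adj G u v ≡ false
switchable {n} G {x} {y} {u} ¬xy xu degu<degy =
  let v , lt = sum-<⇒∃ {n} {λ i → bit (adj G u i) + δ u i} {λ i → bit (adj G y i) + δ x i}
                 (subst₂ _<_ (sym (sum-adj+δ G u u)) (sym (sum-adj+δ G y x)) (s≤s degu<degy))
  in v , witness v lt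
  where
  witness : ∀ v → bit (adj G u v) + δ u v < bit (adj G y v) + δ x v →
            adj G y v ≡ true × u ≢ v × adj G u v ≡ false
  witness v lt with x ≟ v
  ... | yes refl
    rewrite trans (adj-sym G u x) xu | trans (adj-sym G y x) ¬xy with () ← s≤s⁻¹ lt
  ... | no _ with adj G y v | adj G u v | u ≟ v
  ...   | true  | false | no u≢v = refl , u≢v , refl
  ...   | true  | false | yes _  with () ← s≤s⁻¹ lt
  ...   | true  | true  | _      with () ← s≤s⁻¹ lt
  ...   | false | _     | _      with () ← lt

-- The vertices `x` and `y` may coincide, and then that vertex loses two.
LowersBy : ∀ {n} → Graph n → (x y : Fin n) → Graph n → Set
LowersBy G x y H = ∀ i → deg H i + (δ x i + δ y i) ≡ deg G i

-- The vertices `u` and `v` each lose one edge and gain one, so only `x` and `y` drop in degree.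
switch : ∀ {n} (G : Graph n) {x y u v} → adj G x y ≡ false → adj G x u ≡ true → adj G y v ≡ true →
         u ≢ v → adj G u v ≡ false → ∃ (LowersBy G x y)
switch G {x} {y} {u} {v} ¬xy xu yv u≢v ¬uv = toggle u≢v G₂ , lowers
  where
  x≢u = adj⇒≢ G xu
  y≢v = adj⇒≢ G yv
  -- If `x` were `v`, or `y` were `u`, then yv or xu would be the absent edge xy.
  x≢v : x ≢ v
  x≢v refl with () ← trans (sym ¬xy) (trans (adj-sym G x y) yv)
  y≢u : y ≢ u
  y≢u refl with () ← trans (sym ¬xy) xu
  G₁ = toggle x≢u G
  -- The three toggled edges are pairwise distinct, so earlier toggles leave the status of the later
  -- ones unchanged.
  yv₁ : adj G₁ y v ≡ true
  yv₁ = cong₂ _xor_ yv (dec-false (edge? x u y v)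
    λ { (inj₁ (_ , u≡v)) → u≢v u≡v ; (inj₂ (x≡v , _)) → x≢v x≡v })
  G₂ = toggle y≢v G₁
  ¬uv₂ : adj G₂ u v ≡ false
  ¬uv₂ = cong₂ _xor_
    (cong₂ _xor_ ¬uv (dec-false (edge? x u u v)
      λ { (inj₁ (x≡u , _)) → x≢u x≡u ; (inj₂ (x≡v , _)) → x≢v x≡v }))
    (dec-false (edge? y v u v)
      λ { (inj₁ (y≡u , _)) → y≢u y≡u ; (inj₂ (y≡v , _)) → y≢v y≡v })
  -- Regroups the gain of the new edge uv with the losses at `x` and `y`, so that the two deletions
  -- can be undone one at a time.
  rearrange : ∀ c x y u v → c + (u + v) + (x + y) ≡ c + (y + v) + (x + u)
  rearrange = solve-∀
  lowers : LowersBy G x y (toggle u≢v G₂)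
  lowers i = begin
    deg (toggle u≢v G₂) i + (δ x i + δ y i)        ≡⟨ cong (_+ _) (deg-add G₂ u≢v ¬uv₂ i) ⟩
    deg G₂ i + (δ u i + δ v i) + (δ x i + δ y i)   ≡⟨ rearrange (deg G₂ i) (δ x i) (δ y i) (δ u i) (δ v i) ⟩
    deg G₂ i + (δ y i + δ v i) + (δ x i + δ u i)   ≡⟨ cong (_+ _) (deg-remove G₁ y≢v yv₁ i) ⟩
    deg G₁ i + (δ x i + δ u i)                     ≡⟨ deg-remove G x≢u xu i ⟩
    deg G i                                        ∎
    where open ≡-Reasoning

-- Removing excess degree in pairs

module Excess {n} (k : ℕ) (k≤n : k ≤ n) (d : Fin n → ℕ)
              (k≤d : ∀ {i} → toℕ i < k → k ≤ d i) (d≤k : ∀ {i} → k ≤ toℕ i → d i ≤ k) where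

  -- Only `k` vertices have index below `k`, too few to contain all neighbours of `x`.
  outer-neighbour : (G : Graph n) → ∀ {x} → k < deg G x → ∃ λ u → k ≤ toℕ u × adj G x u ≡ true
  outer-neighbour G {x} k<deg
    with u , lt ← sum-<⇒∃ (subst (_< deg G x) (sym (sum-𝟙-< k≤n)) k<deg)
    = u , ≮⇒≥ outer , bit>0 lt
    where
    outer : ¬ toℕ u < k
    outer u<k = <⇒≱ (subst (_< bit (adj G x u)) (𝟙-true (toℕ u <? k) u<k) lt) (bit≤1 (adj G x u))

  -- The case `x` = `y` falls under non-adjacency, since the diagonal of the matrix is `false`.
  -- Otherwise an outer neighbour `u` of `x` has degree at most `k`, hence less than that of `y`, as
  -- `switchable` requires.
  lower : (G : Graph n) → (∀ {i} → k ≤ toℕ i → deg G i ≤ k) →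
          ∀ {x y} → k < deg G x → k < deg G y → ∃ (LowersBy G x y)
  lower G deg≤k {x} {y} k<x k<y with adj G x y in xy
  ... | true = toggle (adj⇒≢ G xy) G , deg-remove G (adj⇒≢ G xy) xy
  ... | false with u , k≤u , xu ← outer-neighbour G k<x
              with v , yv , u≢v , ¬uv ← switchable G xy xu (≤-<-trans (deg≤k k≤u) k<y)
    = switch G xy xu yv u≢v ¬uv

  -- Induction on the number `m` of pairs of excess units. The excess stays zero from index `k` on,
  -- which keeps the outer degrees at most `k` for the next round.
  remove-excess : ∀ m (G : Graph n) (e : Fin n → ℕ) → (∀ i → deg G i ≡ d i + e i) →
                  (∀ {i} → k ≤ toℕ i → e i ≡ 0) → sum e ≡ m * 2 → ∃ λ H → ∀ i → deg H i ≡ d i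
  remove-excess zero G e deg≡ _ ∑e≡0 =
    G , λ i → trans (deg≡ i) (trans (cong (d i +_) (sum≡0⇒≡0 ∑e≡0 i)) (+-identityʳ (d i)))
  remove-excess (suc m) G e deg≡ e≡0 ∑e
    with x , e₁ , e≡  , ∑e₁ ← δ-split e ∑e
    with y , e₂ , e₁≡ , ∑e₂ ← δ-split e₁ ∑e₁
    = remove-excess m H e₂ deg-H e₂≡0 ∑e₂
    where
    e≡₂ : ∀ i → e i ≡ δ x i + δ y i + e₂ i
    e≡₂ i = trans (e≡ i) (trans (cong (δ x i +_) (e₁≡ i)) (sym (+-assoc (δ x i) _ _)))
    ex>0 : 0 < e x
    ex>0 = subst (0 <_) (sym (trans (e≡ x) (cong (_+ e₁ x) (δ-refl x)))) (s≤s z≤n)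
    ey>0 : 0 < e y
    ey>0 = subst (0 <_) (sym (e≡ y)) (<-≤-trans e₁y>0 (m≤n+m (e₁ y) (δ x y)))
      where
      e₁y>0 : 0 < e₁ y
      e₁y>0 = subst (0 <_) (sym (trans (e₁≡ y) (cong (_+ e₂ y) (δ-refl y)))) (s≤s z≤n)
    deg≤k : ∀ {i} → k ≤ toℕ i → deg G i ≤ k
    deg≤k {i} k≤i = ≤-trans
      (≤-reflexive (trans (deg≡ i) (trans (cong (d i +_) (e≡0 k≤i)) (+-identityʳ (d i))))) (d≤k k≤i)
    -- Positive excess forces the index below `k`, where already `k ≤ d i`.
    k<deg : ∀ {i} → 0 < e i → k < deg G i
    k<deg {i} ei>0 = subst (k <_) (sym (deg≡ i))
      (subst (_≤ d i + e i) (+-comm k 1) (+-mono-≤ (k≤d (≰⇒> λ k≤i → >⇒≢ ei>0 (e≡0 k≤i))) ei>0))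
    lowered = lower G deg≤k (k<deg ex>0) (k<deg ey>0)
    H = proj₁ lowered
    deg-H : ∀ i → deg H i ≡ d i + e₂ i
    deg-H i = +-cancelʳ-≡ (δ x i + δ y i) _ _ (begin
      deg H i + (δ x i + δ y i)       ≡⟨ proj₂ lowered i ⟩
      deg G i                         ≡⟨ deg≡ i ⟩
      d i + e i                       ≡⟨ cong (d i +_) (trans (e≡₂ i) (+-comm _ (e₂ i))) ⟩
      d i + (e₂ i + (δ x i + δ y i))  ≡⟨ +-assoc (d i) _ _ ⟨
      d i + e₂ i + (δ x i + δ y i)    ∎)
      where open ≡-Reasoning
    e₂≡0 : ∀ {i} → k ≤ toℕ i → e₂ i ≡ 0
    e₂≡0 {i} k≤i = m+n≡0⇒n≡0 (δ x i + δ y i) (trans (sym (e≡₂ i)) (e≡0 k≤i))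

-- Comparison of degree sums

-- Outside S, both graphs spend the same total degree; H spends all of it on edges
-- into S, and has every edge inside S.
split-maximal : ∀ {n} (G H : Graph n) (S : Fin n → Bool) →
                (∀ i j → S i ≡ true → S j ≡ true → i ≢ j → adj H i j ≡ true) →
                (∀ i j → S i ≡ false → S j ≡ false → adj H i j ≡ false) →
                (∀ i → S i ≡ false → deg G i ≡ deg H i) →
                ∑[ i < n ] (bit (S i) * deg G i) ≤ ∑[ i < n ] (bit (S i) * deg H i)
split-maximal {n} G H S clique indep same = begin
  ∑[ i < n ] (bit (S i) * deg G i)
    ≡⟨ sum-cong-≗ (λ i → *-distribˡ-sum (bit (S i)) (A G i)) ⟩
  ∑[ i < n ] ∑[ j < n ] (bit (S i) * A G i j)
    ≤⟨ sum-mono (λ i → sum-mono (below i)) ⟩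
  ∑[ i < n ] ∑[ j < n ] (inside i j + bit (not (S j)) * A G i j)
    ≡⟨ split G ⟩
  (∑[ i < n ] sum (inside i)) + ∑[ j < n ] (bit (not (S j)) * deg G j)
    ≡⟨ cong ((∑[ i < n ] sum (inside i)) +_) (sum-cong-≗ same′) ⟩
  (∑[ i < n ] sum (inside i)) + ∑[ j < n ] (bit (not (S j)) * deg H j)
    ≡⟨ split H ⟨
  ∑[ i < n ] ∑[ j < n ] (inside i j + bit (not (S j)) * A H i j)
    ≤⟨ sum-mono (λ i → sum-mono (above i)) ⟩
  ∑[ i < n ] ∑[ j < n ] (bit (S i) * A H i j)
    ≡⟨ sum-cong-≗ (λ i → *-distribˡ-sum (bit (S i)) (A H i)) ⟨
  ∑[ i < n ] (bit (S i) * deg H i) ∎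
  where
  open ≤-Reasoning
  A : Graph n → Fin n → Fin n → ℕ
  A K i j = bit (adj K i j)
  -- Taken from `H` in both bounds: it dominates the edges of `G` inside `S` and is exact for `H`.
  inside : Fin n → Fin n → ℕ
  inside i j = bit (S i) * (bit (S j) * A H i j)

  below : ∀ i j → bit (S i) * A G i j ≤ inside i j + bit (not (S j)) * A G i j
  below i j with S i in Si | S j in Sj
  ... | false | _     = z≤n
  ... | true  | false = ≤-refl
  ... | true  | true with i ≟ j
  ...   | yes refl rewrite adj-irrefl G i = z≤n
  ...   | no i≢j rewrite clique i j Si Sj i≢j =
    ≤-trans (≤-reflexive (*-identityˡ (A G i j))) (bit≤1 (adj G i j))

  above : ∀ i j → inside i j + bit (not (S j)) * A H i j ≤ bit (S i) * A H i j
  above i j with S i in Si | S j in Sj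
  ... | false | false rewrite indep i j Si Sj = z≤n
  ... | false | true  = z≤n
  ... | true  | false = ≤-refl
  ... | true  | true  =
    ≤-reflexive (trans (+-identityʳ _) (cong (1 *_) (*-identityˡ (A H i j))))

  same′ : ∀ j → bit (not (S j)) * deg G j ≡ bit (not (S j)) * deg H j
  same′ j with S j in Sj
  ... | true  = refl
  ... | false = cong (1 *_) (same j Sj)

  split : ∀ K → ∑[ i < n ] ∑[ j < n ] (inside i j + bit (not (S j)) * A K i j) ≡
                (∑[ i < n ] sum (inside i)) + ∑[ j < n ] (bit (not (S j)) * deg K j)
  -- Exchanging the order of summation and using symmetry turns the column sums into degrees.
  split K =
    trans (sum-cong-≗ λ i → ∑-distrib-+ (inside i) (λ j → bit (not (S j)) * A K i j))
    (trans (∑-distrib-+ (λ i → sum (inside i)) (λ i → ∑[ j < n ] (bit (not (S j)) * A K i j)))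
    (cong (_ +_)
    (trans (∑-comm (λ i j → bit (not (S j)) * A K i j))
    (sum-cong-≗ λ j →
      trans (sum-cong-≗ λ i → cong (λ x → bit (not (S j)) * bit x) (adj-sym K i j))
            (sym (*-distribˡ-sum (bit (not (S j))) (A K j)))))))

-- The part of a Ferrers diagram below its diagonal, as a graph

-- A downward closed set of indices is an initial segment, so its size is its cut-off. If the first
-- index fails, all fail; otherwise drop it and shift.
prefix : ∀ {n ℓ} {P : Fin n → Set ℓ} (P? : ∀ i → Dec (P i)) →
         (∀ {i j} → toℕ i ≤ toℕ j → P j → P i) →
         ∀ i → P i ⇔ toℕ i < ∑[ j < n ] 𝟙 (P? j)
prefix {suc n} {P = P} P? down i with P? zero
... | no ¬P₀ = mk⇔ (λ Pi → contradiction (down z≤n Pi) ¬P₀)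
                   (λ i<0 → contradiction (subst (toℕ i <_) none i<0) n≮0)
  where
  none : ∑[ j < n ] 𝟙 (P? (suc j)) ≡ 0
  none = sum-zero λ j → 𝟙-false (P? (suc j)) (¬P₀ ∘ down z≤n)
prefix {suc n} P? down zero    | yes P₀ = mk⇔ (λ _ → s≤s z≤n) (λ _ → P₀)
prefix {suc n} P? down (suc i) | yes P₀ = mk⇔ (s≤s ∘ to eqv) (from eqv ∘ s≤s⁻¹)
  where eqv = prefix (P? ∘ suc) (down ∘ s≤s) i

module Ferrers {n} (d : Fin n → ℕ) (antitone : ∀ {i j} → toℕ i ≤ toℕ j → d j ≤ d i) where

  -- With rows numbered from 0, this is the condition d_m ≥ m at m = i + 1, so `k` is the length of
  -- the diagonal.
  high? : ∀ i → Dec (toℕ i < d i)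
  high? i = toℕ i <? d i

  k : ℕ
  k = ∑[ i < n ] 𝟙 (high? i)

  high⇔ : ∀ i → toℕ i < d i ⇔ toℕ i < k
  high⇔ = prefix high? λ i≤j j<dj → ≤-<-trans i≤j (<-≤-trans j<dj (antitone i≤j))

  k≤n : k ≤ n
  k≤n = sum-bit≤n (does ∘ high?)

  -- This and `d≤k` are the bounds of the Durfee square. If `d i < k`, the row `j` of index `d i`
  -- meets the diagonal, so `d j > d i`, although it does not precede row `i`.
  k≤d : ∀ {i} → toℕ i < k → k ≤ d i
  k≤d {i} i<k = ≮⇒≥ impossible
    where
    impossible : ¬ d i < k
    impossible di<k = <-irrefl refl (<-≤-trans di<dj (antitone i≤j))
      where
      di<n = <-≤-trans di<k k≤n
      j    = fromℕ< di<n
      j≡di = toℕ-fromℕ< di<n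
      i≤j : toℕ i ≤ toℕ j
      i≤j = ≤-trans (<⇒≤ (from (high⇔ i) i<k)) (≤-reflexive (sym j≡di))
      di<dj : d i < d j
      di<dj = subst (_< d j) j≡di (from (high⇔ j) (subst (_< k) (sym j≡di) di<k))

  -- Row `k` exists because `k ≤ toℕ i < n`; it misses the diagonal, so it has at most `k` cells,
  -- and later rows have no more.
  d≤k : ∀ {i} → k ≤ toℕ i → d i ≤ k
  d≤k {i} k≤i = ≤-trans (antitone (≤-trans (≤-reflexive j≡k) k≤i))
    (subst (d j ≤_) j≡k (≮⇒≥ λ j<dj → <⇒≢ (to (high⇔ j) j<dj) j≡k))
    where
    k<n = ≤-<-trans k≤i (toℕ<n i)
    j   = fromℕ< k<n
    j≡k = toℕ-fromℕ< k<n

  below? : ∀ (i j : Fin n) → Dec (toℕ i < toℕ j × toℕ i < d j)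
  below? i j = (toℕ i <? toℕ j) ×-dec (toℕ i <? d j)

  leg : Fin n → ℕ
  leg i = ∑[ j < n ] 𝟙 (below? i j)

  ferrers : Graph n
  ferrers = record
    { adj        = λ i j → does (below? i j ⊎-dec below? j i)
    ; adj-irrefl = λ i → dec-false (below? i i ⊎-dec below? i i)
        λ { (inj₁ (i<i , _)) → <-irrefl refl i<i ; (inj₂ (i<i , _)) → <-irrefl refl i<i }
    ; adj-sym    = λ i j → does-⇔ (mk⇔ swap swap) (below? i j ⊎-dec below? j i) (below? j i ⊎-dec below? i j)
    }

  deg-ferrers : ∀ i → deg ferrers i ≡ leg i + ∑[ j < n ] 𝟙 (below? j i)
  deg-ferrers i = trans
    (sum-cong-≗ λ j → 𝟙-⊎ (below? i j) (below? j i) λ { ((i<j , _) , (j<i , _)) → <-asym i<j j<i })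
    (∑-distrib-+ (λ j → 𝟙 (below? i j)) (λ j → 𝟙 (below? j i)))

  -- When row `i` meets the diagonal, it meets every column `j < i`, so all earlier vertices are
  -- neighbours.
  deg-high : ∀ {i} → toℕ i < d i → deg ferrers i ≡ leg i + toℕ i
  deg-high {i} i<d = trans (deg-ferrers i) (cong (leg i +_) (trans
    (sum-cong-≗ λ j → 𝟙-⇔ (mk⇔ proj₁ λ j<i → j<i , <-trans j<i i<d) (below? j i) (toℕ j <? toℕ i))
    (sum-𝟙-< (<⇒≤ (toℕ<n i)))))

  -- No later row reaches column `i`, so the leg is empty; the earlier neighbours are exactly the
  -- columns that row `i` meets.
  deg-low : ∀ {i} → d i ≤ toℕ i → deg ferrers i ≡ d i
  deg-low {i} d≤i = trans (deg-ferrers i) (cong₂ _+_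
    (sum-zero λ j → 𝟙-false (below? i j)
      λ { (i<j , i<dj) → <⇒≱ i<dj (≤-trans (antitone (<⇒≤ i<j)) d≤i) })
    (trans
      (sum-cong-≗ λ j → 𝟙-⇔ (mk⇔ proj₂ λ j<d → <-≤-trans j<d d≤i , j<d) (below? j i) (toℕ j <? d i))
      (sum-𝟙-< (≤-trans d≤i (<⇒≤ (toℕ<n i))))))

  low : ∀ {i} → ¬ toℕ i < k → d i ≤ toℕ i
  low {i} i≮k = ≮⇒≥ (i≮k ∘ to (high⇔ i))

  realisable : (∀ {i} → toℕ i < k → d i ≤ leg i + toℕ i) → 2 ∣ sum d →
               ∃ λ (G : Graph n) → ∀ i → deg G i ≡ d i
  realisable d≤ even =
    -- The quotient by 2 is the number of pairs to remove.
    Excess.remove-excess k k≤n d k≤d d≤k (_∣_.quotient even-excess) ferrers excess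
      (λ i → sym (m+[n∸m]≡n (d≤deg i)))
      (λ {i} k≤i → m≤n⇒m∸n≡0 (≤-reflexive (deg-low (low (≤⇒≯ k≤i))))) (_∣_.equality even-excess)
    where
    excess : Fin n → ℕ
    excess i = deg ferrers i ∸ d i
    d≤deg : ∀ i → d i ≤ deg ferrers i
    d≤deg i with toℕ i <? k
    ... | yes i<k = ≤-trans (d≤ i<k) (≤-reflexive (sym (deg-high (from (high⇔ i) i<k))))
    ... | no  i≮k = ≤-reflexive (sym (deg-low (low i≮k)))
    -- The total excess is the difference of two even numbers: the degree sum of `ferrers` and the
    -- sum of `d`.
    even-excess : 2 ∣ sum excess
    even-excess = ∣m+n∣m⇒∣n (subst (2 ∣_)
      (trans (sum-cong-≗ λ i → sym (m+[n∸m]≡n (d≤deg i))) (∑-distrib-+ d excess)) (handshake ferrers)) even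

  -- The `suc` distributes the summand `k` of the sum condition, one unit per diagonal row. Adding
  -- `toℕ i` then restores `d i`, since the truncated subtraction is exact on these rows.
  realised⇒≤ : (G : Graph n) → (∀ i → deg G i ≡ d i) →
               ∑[ i < n ] (𝟙 (toℕ i <? k) * suc (d i ∸ suc (toℕ i))) ≤ ∑[ i < n ] (𝟙 (toℕ i <? k) * leg i)
  realised⇒≤ G deg≡ = +-cancelʳ-≤ indices _ _ (begin
    ∑[ i < n ] (h i * suc (d i ∸ suc (toℕ i))) + indices   ≡⟨ join (λ i → suc (d i ∸ suc (toℕ i))) ⟩
    ∑[ i < n ] (h i * (suc (d i ∸ suc (toℕ i)) + toℕ i))   ≡⟨ sum-cong-≗ arm ⟩
    ∑[ i < n ] (h i * deg G i)                             ≤⟨ split-maximal G ferrers S clique indep same ⟩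
    ∑[ i < n ] (h i * deg ferrers i)                       ≡⟨ sum-cong-≗ leg′ ⟩
    ∑[ i < n ] (h i * (leg i + toℕ i))                     ≡⟨ join leg ⟨
    ∑[ i < n ] (h i * leg i) + indices                     ∎)
    where
    open ≤-Reasoning
    S : Fin n → Bool
    S i = does (toℕ i <? k)
    h : Fin n → ℕ
    h i = bit (S i)
    indices = ∑[ i < n ] (h i * toℕ i)
    S-high : ∀ {i} → S i ≡ true → toℕ i < d i
    S-high {i} Si = from (high⇔ i) (invert (subst (Reflects _) Si (proof (toℕ i <? k))))
    S-low : ∀ {i} → S i ≡ false → d i ≤ toℕ i
    S-low {i} Si = low (invert (subst (Reflects _) Si (proof (toℕ i <? k))))
    join : ∀ (t : Fin n → ℕ) → ∑[ i < n ] (h i * t i) + indices ≡ ∑[ i < n ] (h i * (t i + toℕ i))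
    join t = trans (sym (∑-distrib-+ (λ i → h i * t i) (λ i → h i * toℕ i)))
                   (sum-cong-≗ λ i → sym (*-distribˡ-+ (h i) (t i) (toℕ i)))
    arm : ∀ i → h i * (suc (d i ∸ suc (toℕ i)) + toℕ i) ≡ h i * deg G i
    arm i with S i in Si
    ... | false = refl
    ... | true  = cong (1 *_) (trans (cong suc (+-comm (d i ∸ suc (toℕ i)) (toℕ i)))
                              (trans (m+[n∸m]≡n (S-high Si)) (sym (deg≡ i))))
    leg′ : ∀ i → h i * deg ferrers i ≡ h i * (leg i + toℕ i)
    leg′ i with S i in Si
    ... | false = refl
    ... | true  = cong (1 *_) (deg-high (S-high Si))
    clique : ∀ i j → S i ≡ true → S j ≡ true → i ≢ j → adj ferrers i j ≡ true
    clique i j Si Sj i≢j = dec-true (below? i j ⊎-dec below? j i) edge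
      where
      edge : (toℕ i < toℕ j × toℕ i < d j) ⊎ (toℕ j < toℕ i × toℕ j < d i)
      edge with <-cmp (toℕ i) (toℕ j)
      ... | tri< i<j _ _ = inj₁ (i<j , <-trans i<j (S-high Sj))
      ... | tri≈ _ i≡j _ = contradiction (Fin.toℕ-injective i≡j) i≢j
      ... | tri> _ _ j<i = inj₂ (j<i , <-trans j<i (S-high Si))
    indep : ∀ i j → S i ≡ false → S j ≡ false → adj ferrers i j ≡ false
    indep i j Si Sj = dec-false (below? i j ⊎-dec below? j i)
      λ { (inj₁ (i<j , i<dj)) → <⇒≱ i<dj (≤-trans (antitone (<⇒≤ i<j)) (S-low Si))
        ; (inj₂ (j<i , j<di)) → <⇒≱ j<di (≤-trans (antitone (<⇒≤ j<i)) (S-low Sj)) }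
    same : ∀ i → S i ≡ false → deg G i ≡ deg ferrers i
    same i Si = trans (deg≡ i) (sym (deg-low (S-low Si)))

-- Translation from lists

part-lookup : ∀ ds (i : Fin (length ds)) → part ds (suc (toℕ i)) ≡ lookup ds i
part-lookup (d ∷ ds)         zero    = refl
part-lookup (d ∷ ds@(_ ∷ _)) (suc i) = part-lookup ds i

sum-lookup : ∀ ds → ∑[ i < length ds ] lookup ds i ≡ List.sum ds
sum-lookup []       = refl
sum-lookup (d ∷ ds) = cong (_+_ d) (sum-lookup ds)

lookup-antitone : ∀ {ds} → AllPairs _≥_ ds → ∀ {i j} → toℕ i ≤ toℕ j → lookup ds j ≤ lookup ds i
lookup-antitone {_ ∷ _} _           {zero}  {zero}  _   = ≤-refl
lookup-antitone {_ ∷ _} (d≥ ∷ _)    {zero}  {suc j} _   = All.lookup d≥ (∈-lookup j)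
lookup-antitone {_ ∷ _} (_  ∷ dec)  {suc i} {suc j} i≤j = lookup-antitone dec (s≤s⁻¹ i≤j)

length-filter-applyUpTo : ∀ {ℓ} {P : Pred ℕ ℓ} (P? : Decidable P) (t : ℕ → ℕ) n →
                          length (filter P? (applyUpTo t n)) ≡ ∑[ i < n ] 𝟙 (P? (t (toℕ i)))
length-filter-applyUpTo P? t zero    = refl
length-filter-applyUpTo P? t (suc n) with does (P? (t 0))
... | true  = cong suc (length-filter-applyUpTo P? (t ∘ suc) n)
... | false = length-filter-applyUpTo P? (t ∘ suc) n

-- Weighting by an indicator lets sums over the diagonal range over all vertices, as the degree sums
-- do.
sum-map-applyUpTo : ∀ (F t : ℕ → ℕ) {m n} → m ≤ n →
                    List.sum (map F (applyUpTo t m)) ≡ ∑[ i < n ] (𝟙 (toℕ i <? m) * F (t (toℕ i)))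
sum-map-applyUpTo F t {n = n} z≤n = sym (sum-zero {n} λ _ → refl)
sum-map-applyUpTo F t (s≤s m≤n)   =
  cong₂ _+_ (sym (*-identityˡ (F (t 0)))) (sum-map-applyUpTo F (t ∘ suc) m≤n)

-- The implication ranges over members of the list, which `∈-partitions` identifies as partitions of
-- n.
length-filter-mono : ∀ {ℓ₁ ℓ₂ ℓ₃} {A : Set ℓ₁} {P : Pred A ℓ₂} {Q : Pred A ℓ₃}
                     (P? : Decidable P) (Q? : Decidable Q) {xs} → All (λ x → P x → Q x) xs →
                     length (filter P? xs) ≤ length (filter Q? xs)
length-filter-mono P? Q? []               = z≤n
length-filter-mono P? Q? (_∷_ {x} P⇒Q Ps) with P? x | Q? x
... | yes _  | yes _ = s≤s (length-filter-mono P? Q? Ps)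
... | yes px | no ¬q = contradiction (P⇒Q px) ¬q
... | no _   | yes _ = m≤n⇒m≤1+n (length-filter-mono P? Q? Ps)
... | no _   | no _  = length-filter-mono P? Q? Ps

-- Simple graphs and Boolean matrices

∣∣-lookup : ∀ {n} (S : Subset n) → ∣ S ∣ ≡ ∑[ i < n ] bit (Vec.lookup S i)
∣∣-lookup Vec.[]           = refl
∣∣-lookup (true  Vec.∷ S)  = cong suc (∣∣-lookup S)
∣∣-lookup (false Vec.∷ S)  = ∣∣-lookup S

fromGraph : ∀ {n} → Graph n → SimpleGraph n
fromGraph G = record
  { neighbours = λ i → Vec.tabulate (adj G i)
  ; irrefl     = λ i i∈ → adj⇒≢ G (member i∈) refl
  ; symmetric  = λ i j j∈ → Vec.lookup⇒[]= i _
      (trans (Vec.lookup∘tabulate (adj G j) i) (trans (adj-sym G j i) (member j∈)))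
  }
  where
  member : ∀ {i j} → Vec.tabulate (adj G i) Vec.[ j ]= true → adj G i j ≡ true
  member {i} {j} j∈ = trans (sym (Vec.lookup∘tabulate (adj G i) j)) (Vec.[]=⇒lookup j∈)

degree-fromGraph : ∀ {n} (G : Graph n) i → degree (fromGraph G) i ≡ deg G i
degree-fromGraph G i = trans (∣∣-lookup (Vec.tabulate (adj G i)))
  (sum-cong-≗ (cong bit ∘ Vec.lookup∘tabulate (adj G i)))

toGraph : ∀ {n} → SimpleGraph n → Graph n
toGraph G = record
  { adj        = λ i j → Vec.lookup (neighbours i) j
  ; adj-irrefl = λ i → ¬-not (irrefl i ∘ Vec.lookup⇒[]= i (neighbours i))
  ; adj-sym    = λ i j → ⇔→≡ (mk⇔ (flipped i j) (flipped j i))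
  }
  where
  open SimpleGraph G
  flipped : ∀ i j → Vec.lookup (neighbours i) j ≡ true → Vec.lookup (neighbours j) i ≡ true
  flipped i j = Vec.[]=⇒lookup ∘ symmetric i j ∘ Vec.lookup⇒[]= j (neighbours i)

m-n≤-1⇒m<n : ∀ {m n} → ℤ.+ m ℤ.- ℤ.+ n ℤ.≤ ℤ.-1ℤ → m < n
m-n≤-1⇒m<n {m} {n} le = ≰⇒> λ n≤m → absurd (subst (ℤ._≤ ℤ.-1ℤ) (trans (ℤ.m-n≡m⊖n m n) (ℤ.⊖-≥ n≤m)) le)
  where
  absurd : ∀ {j} → ¬ ℤ.+ j ℤ.≤ ℤ.-1ℤ
  absurd ()

-- The Frobenius conditions of a partition

module _ {n ds} (partition : IsPartition n ds) where

  open IsPartition partition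
  open Ferrers (lookup ds) (lookup-antitone (Linked⇒AllPairs (λ x≥y y≥z → ≤-trans y≥z x≥y) decreasing))

  diagonal≡k : diagonal ds ≡ k
  diagonal≡k = trans (length-filter-applyUpTo (λ m → m ≤? part ds m) suc (length ds))
    -- At the 1-based index `suc (toℕ i)`, the test `m ≤? part ds m` is already a strict test at
    -- `toℕ i`.
    (sum-cong-≗ λ i → cong (λ x → 𝟙 (toℕ i <? x)) (part-lookup ds i))

  b≡leg : ∀ i → b ds (suc (toℕ i)) ≡ leg i
  b≡leg i = trans
    (length-filter-applyUpTo (λ j → (suc (toℕ i) <? j) ×-dec (suc (toℕ i) ≤? part ds j)) suc (length ds))
    (sum-cong-≗ λ j → cong (λ x → 𝟙 ((toℕ i <? toℕ j) ×-dec (toℕ i <? x))) (part-lookup ds j))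

  a≡arm : ∀ i → a ds (suc (toℕ i)) ≡ lookup ds i ∸ suc (toℕ i)
  a≡arm i = cong (_∸ suc (toℕ i)) (part-lookup ds i)

  graphical⇒sumCondition : Graphical ds → SumCondition ds
  graphical⇒sumCondition (G , degree≡) rewrite diagonal≡k = begin
    k + List.sum (map (a ds) [1⋯ k ])
      -- Written as a sum of indicators, `k` merges with the arms term by term.
      ≡⟨ cong₂ _+_ (sym (sum-𝟙-< k≤n)) (sum-map-applyUpTo (a ds) suc k≤n) ⟩
    sum h + ∑[ i < length ds ] (h i * a ds (suc (toℕ i)))
      ≡⟨ ∑-distrib-+ h (λ i → h i * a ds (suc (toℕ i))) ⟨
    ∑[ i < length ds ] (h i + h i * a ds (suc (toℕ i)))
      ≡⟨ sum-cong-≗ (λ i → trans (sym (*-suc (h i) _)) (cong (λ x → h i * suc x) (a≡arm i))) ⟩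
    ∑[ i < length ds ] (h i * suc (lookup ds i ∸ suc (toℕ i)))
      ≤⟨ realised⇒≤ (toGraph G) (λ i → trans (sym (∣∣-lookup (SimpleGraph.neighbours G i))) (degree≡ i)) ⟩
    ∑[ i < length ds ] (h i * leg i)
      ≡⟨ sum-cong-≗ (λ i → cong (h i *_) (b≡leg i)) ⟨
    ∑[ i < length ds ] (h i * b ds (suc (toℕ i)))
      ≡⟨ sum-map-applyUpTo (b ds) suc k≤n ⟨
    List.sum (map (b ds) [1⋯ k ]) ∎
    where
    open ≤-Reasoning
    h : Fin (length ds) → ℕ
    h i = 𝟙 (toℕ i <? k)

  termwiseCondition⇒graphical : 2 ∣ n → TermwiseCondition ds → Graphical ds
  termwiseCondition⇒graphical even termwise = fromGraph G , λ i → trans (degree-fromGraph G i) (deg≡ i)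
    where
    d≤leg+i : ∀ {i} → toℕ i < k → lookup ds i ≤ leg i + toℕ i
    d≤leg+i {i} i<k = begin
      lookup ds i                                        ≡⟨ m∸n+n≡m (from (high⇔ i) i<k) ⟨
      lookup ds i ∸ suc (toℕ i) + suc (toℕ i)            ≡⟨ +-suc _ (toℕ i) ⟩
      -- The termwise condition is the strict inequality a_m < b_m, whose spare unit absorbs the
      -- diagonal cell.
      suc (lookup ds i ∸ suc (toℕ i)) + toℕ i            ≤⟨ +-monoˡ-≤ (toℕ i) arm<leg ⟩
      leg i + toℕ i                                      ∎
      where
      open ≤-Reasoning
      arm<leg : lookup ds i ∸ suc (toℕ i) < leg i
      arm<leg = subst₂ _<_ (a≡arm i) (b≡leg i)
        (m-n≤-1⇒m<n (All.applyUpTo⁻ suc (diagonal ds) termwise (subst (toℕ i <_) (sym diagonal≡k) i<k)))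
    realisation = realisable d≤leg+i (subst (2 ∣_) (sym (trans (sum-lookup ds) total)) even)
    G    = proj₁ realisation
    deg≡ = proj₂ realisation

mainTheorem1 : (n : ℕ) → 0 < n → 2 ∣ n → f′ n ≤ g n × g n ≤ f n × f n ≤ p n
mainTheorem1 n _ even =
    length-filter-mono termwiseCondition? graphical? {partitions n}
      (All.tabulate λ ds∈ → termwiseCondition⇒graphical (to (∈-partitions {n}) ds∈) even)
  , length-filter-mono graphical? sumCondition? {partitions n}
      (All.tabulate λ ds∈ → graphical⇒sumCondition (to (∈-partitions {n}) ds∈))
  , List.length-filter sumCondition? (partitions n)
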